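{- Let $X$ be a countable, second countable topological space, let $H$ be the union of all minimal non-empty open subsets of $X$ (minimal with respect to inclusion among the non-empty open subsets of $X$), and let $L$ be the interior of $X\setminus H$. If there are infinitely many pairwise disjoint open subsets of $X$ contained in $X\setminus H$ (equivalently, contained in $L$), then $\mathcal{M}(X)$ is $\boldsymbol{\Pi}^0_3$-complete; otherwise $\mathcal{M}(X)\in\boldsymbol{\Sigma}^0_2(\mathcal{P}(X))$.
   Context: "Countable" means countably infinite (the paper writes "at most countable" when finite sets are allowed). For a topological space $X$, a subset $A\subseteq X$ is dense in an open set $U$ if $U\subseteq\overline{A}$, and codense in $U$ if $U\subseteq\overline{X\setminus A}$. A subset $A\subseteq X$ is monitorable if for every non-empty open set $U\subseteq X$ either $A$ is not dense in $U$ or $A$ is not codense in $U$. $\mathcal{M}(X)\subseteq\mathcal{P}(X)$ denotes the family of monitorable subsets of $X$. The powerset $\mathcal{P}(X)$ is identified with $2^X$ via characteristic functions and carries the product topology (with $2=\{0,1\}$ discrete); for countable $X$ it is homeomorphic to the Cantor space. $\boldsymbol{\Sigma}^0_\alpha,\boldsymbol{\Pi}^0_\alpha$ are the usual classes of the Borel hierarchy ($\boldsymbol{\Sigma}^0_1$ = open sets, $\boldsymbol{\Pi}^0_\alpha$ = complements of $\boldsymbol{\Sigma}^0_\alpha$ sets, $\boldsymbol{\Sigma}^0_\alpha$ = at most countable unions of sets in $\bigcup_{\beta<\alpha}\boldsymbol{\Pi}^0_\beta$ for $\alpha\geq 2$). For a boldface pointclass $\boldsymbol{\Gamma}$ and a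 Polish space $Z$, a set $A\subseteq Z$ is $\boldsymbol{\Gamma}$-hard if for every zero-dimensional Polish space $Y$ and every $B\in\boldsymbol{\Gamma}(Y)$ there is a continuous $f:Y\to Z$ with $B=f^{ -1}(A)$; $A$ is $\boldsymbol{\Gamma}$-complete if $A\in\boldsymbol{\Gamma}(Z)$ and $A$ is $\boldsymbol{\Gamma}$-hard. -}

module Defs where

open import Level using (Level; 0ℓ; _⊔_) renaming (suc to lsuc)
open import Data.Bool using (Bool; true)
open import Data.List using (List; []; _++_)
open import Data.List.Membership.Propositional using () renaming (_∈_ to _∈ₗ_)
open import Data.List.Membership.Propositional.Properties using (∈-++⁺ˡ; ∈-++⁺ʳ; ∈-++⁻)
open import Data.Maybe using (Maybe; just)
open import Data.Nat as ℕ using (ℕ)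
open import Data.Product using (Σ-syntax; ∃-syntax; _×_; _,_)
open import Data.Rational as ℚ using (ℚ; 0ℚ; 1ℚ)
import Data.Rational.Properties as ℚₚ
open import Data.Sum using (_⊎_; inj₁; inj₂)
open import Function.Bundles using (Func; Inverse; _⇔_; _⟨$⟩_)
import Function.Relation.Binary.Setoid.Equality as FuncSetoid
open import Relation.Binary.Bundles using (Setoid)
open import Relation.Binary.Definitions using (_Respects_)
open import Relation.Binary.PropositionalEquality using (_≡_; _≢_; sym; trans; subst)
import Relation.Binary.PropositionalEquality.Properties as ≡ₚ
open import Relation.Nullary using (¬_)
open import Relation.Unary using (Pred; _∈_; _⊆_; _≐_; _≬_; ∁; _∩_; ⋃; U; _⊢_; Satisfiable)

private
  variable
    ℓ ℓ₁ ℓ₂ : Level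

-- Points form a setoid, since the points of 2^X are functions and these are
-- compared pointwise.  Closure under unions is asked for families indexed by
-- small types; under excluded middle every subset is coextensive with one given
-- by a Bool-valued function, so this covers arbitrary families of opens.

record Space : Set₁ where
  field
    setoid : Setoid 0ℓ 0ℓ
  open Setoid setoid public
    using (Carrier; _≈_) renaming (refl to ≈-refl; sym to ≈-sym; trans to ≈-trans)
  field
    IsOpen    : Pred (Pred Carrier 0ℓ) 0ℓ
    open-≐    : ∀ {V W} → V ≐ W → IsOpen V → IsOpen W
    open-resp : ∀ {V} → IsOpen V → V Respects _≈_
    open-U    : IsOpen U
    open-∩    : ∀ {V W} → IsOpen V → IsOpen W → IsOpen (V ∩ W)
    open-⋃    : (I : Set) (V : I → Pred Carrier 0ℓ) → (∀ i → IsOpen (V i)) → IsOpen (⋃ I V)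

∣_∣ : Space → Set
∣ X ∣ = Space.Carrier X

module _ (X : Space) where
  open Space X

  NonEmptyOpen : Pred (Pred Carrier 0ℓ) 0ℓ
  NonEmptyOpen V = IsOpen V × Satisfiable V

  Clopen : Pred (Pred Carrier 0ℓ) 0ℓ
  Clopen V = IsOpen V × IsOpen (∁ V)

  Closure : Pred Carrier ℓ → Pred Carrier (lsuc 0ℓ ⊔ ℓ)
  Closure A x = ∀ V → IsOpen V → x ∈ V → V ≬ A

  Interior : Pred Carrier ℓ → Pred Carrier (lsuc 0ℓ ⊔ ℓ)
  Interior A x = Σ[ V ∈ Pred Carrier 0ℓ ] IsOpen V × V ⊆ A × x ∈ V

  DenseIn : Pred Carrier ℓ₁ → Pred Carrier ℓ₂ → Set (lsuc 0ℓ ⊔ ℓ₁ ⊔ ℓ₂)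
  DenseIn A V = V ⊆ Closure A

  CodenseIn : Pred Carrier ℓ₁ → Pred Carrier ℓ₂ → Set (lsuc 0ℓ ⊔ ℓ₁ ⊔ ℓ₂)
  CodenseIn A V = V ⊆ Closure (∁ A)

  CountablyInfinite : Set
  CountablyInfinite = Inverse (≡ₚ.setoid ℕ) setoid

  -- A finite base is covered by repeating a member.
  SecondCountable : Set₁
  SecondCountable =
    Σ[ B ∈ (ℕ → Pred Carrier 0ℓ) ]
      (∀ n → IsOpen (B n)) ×
      (∀ V → IsOpen V → ∀ x → x ∈ V → ∃[ n ] (x ∈ B n × B n ⊆ V))

  -- The range of a partial sequence is an at most countable, possibly empty, set.
  Separable : Set₁
  Separable = Σ[ s ∈ (ℕ → Maybe Carrier) ] DenseIn (λ x → ∃[ n ] s n ≡ just x) U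

  ZeroDimensional : Set₁
  ZeroDimensional =
    ∀ V → IsOpen V → ∀ x → x ∈ V →
      Σ[ W ∈ Pred Carrier 0ℓ ] Clopen W × x ∈ W × W ⊆ V

  MinimalOpen : Pred (Pred Carrier 0ℓ) (lsuc 0ℓ)
  MinimalOpen V = NonEmptyOpen V × (∀ W → NonEmptyOpen W → W ⊆ V → W ≐ V)

  H : Pred Carrier (lsuc 0ℓ)
  H x = Σ[ V ∈ Pred Carrier 0ℓ ] MinimalOpen V × x ∈ V

  L : Pred Carrier (lsuc 0ℓ)
  L = Interior (∁ H)

  -- The members of the family are pairwise distinct as sets, hence all but at
  -- most one of them are non-empty.
  InfinitelyManyDisjointOpensIn : Pred Carrier ℓ → Set (lsuc 0ℓ ⊔ ℓ)
  InfinitelyManyDisjointOpensIn S =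
    Σ[ V ∈ (ℕ → Pred Carrier 0ℓ) ]
      (∀ n → IsOpen (V n)) ×
      (∀ n → V n ⊆ S) ×
      (∀ m n → m ≢ n → ¬ (V m ≐ V n)) ×
      (∀ m n → m ≢ n → ¬ (V m ≬ V n))

-- A non-negative real a is represented by its upper cut { q ∈ ℚ ∣ a < q }.
-- Classically these are exactly the inhabited rounded upper sets of positive
-- rationals.

record ℝ≥0 : Set₁ where
  field
    above     : Pred ℚ 0ℓ
    inhabited : Satisfiable above
    positive  : ∀ {q} → q ∈ above → 0ℚ ℚ.< q
    rounded   : ∀ {q} → q ∈ above → ∃[ p ] (p ℚ.< q × p ∈ above)
    upward    : ∀ {p q} → p ℚ.< q → p ∈ above → q ∈ above
open ℝ≥0

infix 4 _<ℚ_ _≤ᴿ_ _≃ᴿ_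
infixl 6 _+ᴿ_

_<ℚ_ : ℝ≥0 → ℚ → Set
a <ℚ q = q ∈ above a

_≤ᴿ_ : ℝ≥0 → ℝ≥0 → Set
a ≤ᴿ b = ∀ q → b <ℚ q → a <ℚ q

_≃ᴿ_ : ℝ≥0 → ℝ≥0 → Set
a ≃ᴿ b = a ≤ᴿ b × b ≤ᴿ a

0ᴿ : ℝ≥0
0ᴿ = record
  { above     = 0ℚ ℚ.<_
  ; inhabited = 1ℚ , ℚₚ.positive⁻¹ 1ℚ
  ; positive  = λ 0<q → 0<q
  ; rounded   = λ 0<q → let m , 0<m , m<q = ℚₚ.<-dense 0<q in m , m<q , 0<m
  ; upward    = λ p<q 0<p → ℚₚ.<-trans 0<p p<q
  }

_+ᴿ_ : ℝ≥0 → ℝ≥0 → ℝ≥0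
a +ᴿ b = record
  { above     = λ q → ∃[ r ] ∃[ s ] (a <ℚ r × b <ℚ s × r ℚ.+ s ℚ.< q)
  ; inhabited = inh
  ; positive  = λ { (r , s , a<r , b<s , r+s<q) →
      ℚₚ.<-trans (ℚₚ.+-mono-< (positive a a<r) (positive b b<s)) r+s<q }
  ; rounded   = λ { (r , s , a<r , b<s , r+s<q) →
      let m , r+s<m , m<q = ℚₚ.<-dense r+s<q in m , m<q , r , s , a<r , b<s , r+s<m }
  ; upward    = λ { p<q (r , s , a<r , b<s , r+s<p) →
      r , s , a<r , b<s , ℚₚ.<-trans r+s<p p<q }
  }
  where
  inh : ∃[ q ] ∃[ r ] ∃[ s ] (a <ℚ r × b <ℚ s × r ℚ.+ s ℚ.< q)
  inh with inhabited a | inhabited b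
  ... | r , a<r | s , b<s =
    (r ℚ.+ s) ℚ.+ 1ℚ , r , s , a<r , b<s ,
    subst (ℚ._< (r ℚ.+ s) ℚ.+ 1ℚ) (ℚₚ.+-identityʳ (r ℚ.+ s))
      (ℚₚ.+-monoʳ-< (r ℚ.+ s) (ℚₚ.positive⁻¹ 1ℚ))

record Metric (S : Setoid 0ℓ 0ℓ) : Set₁ where
  open Setoid S using (Carrier; _≈_)
  field
    d          : Carrier → Carrier → ℝ≥0
    d-zero     : ∀ x y → d x y ≃ᴿ 0ᴿ ⇔ x ≈ y
    d-sym      : ∀ x y → d x y ≃ᴿ d y x
    d-triangle : ∀ x y z → d x z ≤ᴿ d x y +ᴿ d y z

  Cauchy : (ℕ → Carrier) → Set
  Cauchy s = ∀ ε → 0ℚ ℚ.< ε → ∃[ N ] (∀ m n → N ℕ.≤ m → N ℕ.≤ n → d (s m) (s n) <ℚ ε)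

  ConvergesTo : (ℕ → Carrier) → Carrier → Set
  ConvergesTo s x = ∀ ε → 0ℚ ℚ.< ε → ∃[ N ] (∀ n → N ℕ.≤ n → d (s n) x <ℚ ε)

  Complete : Set
  Complete = ∀ s → Cauchy s → ∃[ x ] ConvergesTo s x

module _ (X : Space) where
  open Space X

  Induces : Metric setoid → Set₁
  Induces μ = ∀ V → IsOpen V ⇔ (∀ x → x ∈ V → ∃[ ε ] (0ℚ ℚ.< ε × (∀ y → d x y <ℚ ε → y ∈ V)))
    where open Metric μ

  Polish : Set₁
  Polish = Separable X × (Σ[ μ ∈ Metric setoid ] Metric.Complete μ × Induces μ)

-- Only the finite levels α ≥ 1 of the hierarchy (α = 0 is uninhabited).  At most
-- countable unions are unions of sequences: repeat a member, or use ∅ ∈ Π⁰₁ for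
-- the empty union.

mutual
  data Σ⁰ (Z : Space) : ℕ → Pred (Pred ∣ Z ∣ 0ℓ) (lsuc 0ℓ) where
    isOpen : ∀ {A} → Space.IsOpen Z A → Σ⁰ Z 1 A
    union  : ∀ {α A} → 2 ℕ.≤ α → (B : ℕ → Pred ∣ Z ∣ 0ℓ) →
             (∀ n → ∃[ β ] (β ℕ.< α × Π⁰ Z β (B n))) →
             A ≐ ⋃ ℕ B → Σ⁰ Z α A

  data Π⁰ (Z : Space) : ℕ → Pred (Pred ∣ Z ∣ 0ℓ) (lsuc 0ℓ) where
    complement : ∀ {α A} → (B : Pred ∣ Z ∣ 0ℓ) → Σ⁰ Z α B → A ≐ ∁ B → Π⁰ Z α A

Pointclass : Set₂
Pointclass = (Z : Space) → Pred (Pred ∣ Z ∣ 0ℓ) (lsuc 0ℓ)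

𝚺⁰ 𝚷⁰ : ℕ → Pointclass
𝚺⁰ α Z = Σ⁰ Z α
𝚷⁰ α Z = Π⁰ Z α

-- A ∈ 𝚪(Z), for a predicate A of any universe level: A is coextensive with a
-- small predicate in 𝚪(Z).
InClass : Pointclass → (Z : Space) → Pred ∣ Z ∣ ℓ → Set (lsuc 0ℓ ⊔ ℓ)
InClass Γ Z A = Σ[ B ∈ Pred ∣ Z ∣ 0ℓ ] A ≐ B × Γ Z B

Continuous : (Y Z : Space) → Func (Space.setoid Y) (Space.setoid Z) → Set₁
Continuous Y Z f = ∀ V → Space.IsOpen Z V → Space.IsOpen Y ((f ⟨$⟩_) ⊢ V)

Hard : Pointclass → (Z : Space) → Pred ∣ Z ∣ ℓ → Set (lsuc 0ℓ ⊔ ℓ)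
Hard Γ Z A =
  (Y : Space) → Polish Y → ZeroDimensional Y → (B : Pred ∣ Y ∣ 0ℓ) → Γ Y B →
    Σ[ f ∈ Func (Space.setoid Y) (Space.setoid Z) ] Continuous Y Z f × B ≐ ((f ⟨$⟩_) ⊢ A)

CompleteFor : Pointclass → (Z : Space) → Pred ∣ Z ∣ ℓ → Set (lsuc 0ℓ ⊔ ℓ)
CompleteFor Γ Z A = InClass Γ Z A × Hard Γ Z A

module _ (X : Space) where
  open Space X

  Subset : Set
  Subset = Func setoid (≡ₚ.setoid Bool)

  ⟦_⟧ : Subset → Pred Carrier 0ℓ
  ⟦ A ⟧ x = A ⟨$⟩ x ≡ true

  -- The box determined by a finite list of coordinate conditions B(x) = b.
  Cylinder : List (Carrier × Bool) → Pred Subset 0ℓ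
  Cylinder c B = ∀ {x b} → (x , b) ∈ₗ c → B ⟨$⟩ x ≡ b

  𝒫-IsOpen : Pred (Pred Subset 0ℓ) 0ℓ
  𝒫-IsOpen V = ∀ A → A ∈ V → ∃[ c ] (A ∈ Cylinder c × Cylinder c ⊆ V)

  𝒫 : Space
  𝒫 = record
    { setoid    = FuncSetoid.setoid setoid (≡ₚ.setoid Bool)
    ; IsOpen    = 𝒫-IsOpen
    ; open-≐    = λ { (V⊆W , W⊆V) oV A A∈W →
        let c , A∈c , c⊆V = oV A (W⊆V A∈W) in c , A∈c , λ {B} B∈c → V⊆W (c⊆V {B} B∈c) }
    ; open-resp = λ { oV {A} {B} A≈B A∈V →
        let c , A∈c , c⊆V = oV A A∈V in c⊆V {B} (λ {x} i → trans (sym (A≈B x)) (A∈c i)) }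
    ; open-U    = λ A _ → [] , (λ ()) , _
    ; open-∩    = λ { oV oW A (A∈V , A∈W) →
        let c , A∈c , c⊆V = oV A A∈V
            e , A∈e , e⊆W = oW A A∈W
        in c ++ e , cyl-++ A c e A∈c A∈e , λ {B} B∈ →
             c⊆V {B} (λ i → B∈ (∈-++⁺ˡ i)) , e⊆W {B} (λ i → B∈ (∈-++⁺ʳ c i)) }
    ; open-⋃    = λ { I V oV A (i , A∈Vi) →
        let c , A∈c , c⊆V = oV i A A∈Vi in c , A∈c , λ {B} B∈c → i , c⊆V {B} B∈c }
    }
    where
    cyl-++ : ∀ A c e → A ∈ Cylinder c → A ∈ Cylinder e → A ∈ Cylinder (c ++ e)
    cyl-++ A c e A∈c A∈e i with ∈-++⁻ c i
    ... | inj₁ j = A∈c j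
    ... | inj₂ j = A∈e j

  Monitorable : Pred Subset (lsuc 0ℓ)
  Monitorable A = ∀ V → NonEmptyOpen X V → ¬ DenseIn X ⟦ A ⟧ V ⊎ ¬ CodenseIn X ⟦ A ⟧ V

{-# OPTIONS --safe #-}
module Submission where

-- A set A is monitorable iff every non-empty open set has a non-empty open subset
-- on which A is constant, and "A is constant on some non-empty open part of W" is
-- an Fσ condition on A; quantifying W over a countable base gives Π⁰₃.
--
-- Hardness.  Call a point thin if its singleton is nowhere dense.  A non-empty open
-- set disjoint from H has thin points outside any given nowhere dense set, so one
-- can choose distinct thin points a(n,k,j), those with first indices n and k inside
-- the k-th basic open set when that lies in the n-th of the disjoint open sets V n.
-- A Gδ set S n of a zero-dimensional Polish space Y is encoded by clopen sets
-- E(n,k,j), disjoint in j, such that y ∈ S n hits every row k and y ∉ S n only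
-- finitely many.  Let f(y) consist of the a(n,k,j) with y ∈ E(n,k,j).  Inside V n it
-- is finite, hence nowhere dense, if y ∉ S n, and dense and codense if y ∈ S n.
--
-- Upper bound in the other case.  A is monitorable iff it is constant on each
-- minimal open set, a closed condition, and monitorable inside L.  On an open set any
-- two of whose non-empty open subsets meet, monitorability is Fσ; any other open set
-- splits.  If the condition for L were not Fσ, successive splittings would produce
-- infinitely many disjoint open sets.

open import Defs
open import Level using (0ℓ; lift; lower) renaming (suc to lsuc)
open import Axiom.ExcludedMiddle using (ExcludedMiddle)
open import Data.Bool using (Bool; true; false)
import Data.Bool.Properties as Boolₚ
open import Data.Empty using (⊥-elim)
open import Data.Integer using (+_; -[1+_])
open import Data.List using ([]; _∷_)
open import Data.List.Relation.Unary.Any using (here; there)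
open import Data.Maybe using (just)
import Data.Maybe.Properties as Maybeₚ
open import Data.Nat as ℕ using (ℕ; zero; suc; _≤_; _<_; z≤n; s≤s; _⊔_)
import Data.Nat.Properties as ℕₚ
open import Data.Product using (Σ-syntax; ∃-syntax; _×_; _,_; proj₁; proj₂)
open import Data.Rational as ℚ using (ℚ; 0ℚ; ½; mkℚ)
import Data.Rational.Properties as ℚₚ
open import Data.Sum using (inj₁; inj₂; [_,_]′)
open import Function.Base using (_∘_; id)
open import Function.Bundles using (Func; Equivalence; _⇔_; _⟨$⟩_; mk⇔)
open import Relation.Binary.Definitions using (tri<; tri≈; tri>)
open import Relation.Binary.PropositionalEquality
  using (_≡_; _≢_; refl; sym; trans; cong; subst)
open import Relation.Nullary using (¬_; Dec; yes; no; does; contradiction)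
open import Relation.Nullary.Decidable
  using (True; toWitness; fromWitness; map′; decidable-stable; dec-true; dec-false; does-⇔)
open import Relation.Unary using (Pred; _∈_; _∉_; _⊆_; _≐_; _≬_; ∁; _∩_; _∪_; ⋃; U; ∅; Satisfiable)

-- Enumerations of pairs, triples and positive rationals; rational arithmetic

abstract
  -- Walks each antidiagonal from `(s , 0)` to `(0 , s)`, then starts the next one.
  unpair : ℕ → ℕ × ℕ
  unpair zero = 0 , 0
  unpair (suc n) with unpair n
  ... | zero  , b = suc b , 0
  ... | suc a , b = a , suc b

  unpair-surjective : ∀ a b → ∃[ n ] unpair n ≡ (a , b)
  unpair-surjective a b = onDiagonal (a ℕ.+ b) a b refl
    where
    onDiagonal : ∀ s a b → a ℕ.+ b ≡ s → ∃[ n ] unpair n ≡ (a , b)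
    onDiagonal s zero zero _ = 0 , refl
    onDiagonal (suc s) (suc a) zero eq
      with n , e ← onDiagonal s zero a (trans (sym (ℕₚ.+-identityʳ a)) (ℕₚ.suc-injective eq)) = suc n , step
      where
      step : unpair (suc n) ≡ (suc a , 0)
      step rewrite e = refl
    onDiagonal s a (suc b) eq
      with n , e ← onDiagonal s (suc a) b (trans (sym (ℕₚ.+-suc a b)) eq) = suc n , step
      where
      step : unpair (suc n) ≡ (a , suc b)
      step rewrite e = refl

  pair : ℕ → ℕ → ℕ
  pair a b = proj₁ (unpair-surjective a b)

  unpair-pair : ∀ a b → unpair (pair a b) ≡ (a , b)
  unpair-pair a b = proj₂ (unpair-surjective a b)

  untriple : ℕ → ℕ × ℕ × ℕ
  untriple t = proj₁ (unpair t) , unpair (proj₂ (unpair t))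

  triple : ℕ → ℕ → ℕ → ℕ
  triple n k j = pair n (pair k j)

  untriple-triple : ∀ n k j → untriple (triple n k j) ≡ (n , k , j)
  untriple-triple n k j rewrite unpair-pair n (pair k j) | unpair-pair k j = refl

  fraction : ℕ → ℚ
  fraction t = + proj₁ (unpair t) ℚ./ suc (proj₂ (unpair t))

  fraction-surjective : ∀ q → 0ℚ ℚ.< q → ∃[ t ] fraction t ≡ q
  fraction-surjective q@(mkℚ (+ a) b _) _ = pair a b , trans
    (cong (λ (a , b) → + a ℚ./ suc b) (unpair-pair a b)) (ℚₚ.↥p/↧p≡p q)
  fraction-surjective (mkℚ -[1+ _ ] _ _) (ℚ.*<* ())

half+half : ∀ ε → ½ ℚ.* ε ℚ.+ ½ ℚ.* ε ≡ ε
half+half ε = trans (sym (ℚₚ.*-distribʳ-+ ε ½ ½)) (ℚₚ.*-identityˡ ε)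

half-positive : ∀ {ε} → 0ℚ ℚ.< ε → 0ℚ ℚ.< ½ ℚ.* ε
half-positive {ε} 0<ε = subst (ℚ._< ½ ℚ.* ε) (ℚₚ.*-zeroʳ ½) (ℚₚ.*-monoʳ-<-pos ½ 0<ε)

p+[q-p]≡q : ∀ p q → p ℚ.+ (q ℚ.- p) ≡ q
p+[q-p]≡q p q = trans (ℚₚ.+-comm p (q ℚ.- p)) (trans (ℚₚ.+-assoc q (ℚ.- p) p)
  (trans (cong (q ℚ.+_) (ℚₚ.+-inverseˡ p)) (ℚₚ.+-identityʳ q)))

p<q⇒0<q-p : ∀ {p q} → p ℚ.< q → 0ℚ ℚ.< q ℚ.- p
p<q⇒0<q-p {p} {q} p<q = subst (ℚ._< q ℚ.- p) (ℚₚ.+-inverseʳ p) (ℚₚ.+-monoˡ-< (ℚ.- p) p<q)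

-- Open sets and metric balls

module OpenSets (Y : Space) where
  open Space Y

  open-∅ : IsOpen ∅
  open-∅ = open-≐ (proj₁ , ⊥-elim) (open-⋃ _ (λ _ → U) ⊥-elim)

  open-∪ : ∀ {V W} → IsOpen V → IsOpen W → IsOpen (V ∪ W)
  open-∪ {V} {W} oV oW = open-≐
    ((λ { (true , v) → inj₁ v ; (false , w) → inj₂ w }) , [ true ,_ , false ,_ ]′)
    (open-⋃ Bool (λ { true → V ; false → W }) (λ { true → oV ; false → oW }))

module MetricSpaces (Y : Space) (μ : Metric (Space.setoid Y)) (ind : Induces Y μ) where
  open Space Y
  open Metric μ

  triangle : ∀ {x y z p q} → d x y <ℚ p → d y z <ℚ q → d x z <ℚ p ℚ.+ q
  triangle {x} {y} {z} {p} {q} xy yz =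
    -- The cut of a sum requires a strict inequality `p′ + q < p + q`, so the bound on `d x y` is
    -- first lowered to some `p′ < p`.
    let p′ , p′<p , xy′ = ℝ≥0.rounded (d x y) xy
    in d-triangle x y z (p ℚ.+ q) (p′ , q , xy′ , yz , ℚₚ.+-monoˡ-< q p′<p)

  d-refl : ∀ x {q} → 0ℚ ℚ.< q → d x x <ℚ q
  d-refl x {q} 0<q = proj₁ (Equivalence.from (d-zero x x) ≈-refl) q 0<q

  Ball : Carrier → ℚ → Pred Carrier 0ℓ
  Ball x q y = d x y <ℚ q

  ball-open : ∀ x q → IsOpen (Ball x q)
  ball-open x q = Equivalence.from (ind _) λ y xy →
    let p , p<q , xy′ = ℝ≥0.rounded (d x y) xy
    in q ℚ.- p , p<q⇒0<q-p p<q , λ z yz →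
         subst (d x z <ℚ_) (p+[q-p]≡q p q) (triangle xy′ yz)

  ballInside : ∀ {V x} → IsOpen V → x ∈ V → ∃[ ε ] (0ℚ ℚ.< ε × Ball x ε ⊆ V)
  ballInside oV x∈V = let ε , 0<ε , b⊆V = Equivalence.to (ind _) oV _ x∈V
                      in ε , 0<ε , λ {y} → b⊆V y

-- Consequences of excluded middle

module Classical (em : ExcludedMiddle (lsuc 0ℓ)) where

  em₀ : ExcludedMiddle 0ℓ
  em₀ = map′ lower (lift {ℓ = lsuc 0ℓ}) em

  stable : {P : Set} → ¬ ¬ P → P
  stable = decidable-stable em₀

  stable-∃ : {A : Set₁} (P : A → Set) → ¬ (∀ x → ¬ P x) → Σ[ x ∈ A ] P x
  stable-∃ P ¬∀¬ = decidable-stable em λ ¬∃ → ¬∀¬ λ x p → ¬∃ (x , p)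

  ∁∁ : {A : Set} {P : Pred A 0ℓ} → P ≐ ∁ (∁ P)
  ∁∁ = (λ p ¬p → ¬p p) , stable

  -- A small proposition with the same truth value, so that large conditions can occur in index
  -- types and in small predicates.
  Small : Set₁ → Set
  Small P = True (em {P})

  true⇒ : {P : Set} → does (em₀ {P}) ≡ true → P
  true⇒ {P} eq = stable λ ¬p → contradiction (trans (sym eq) (dec-false em₀ ¬p)) λ ()

  false⇒ : {P : Set} → does (em₀ {P}) ≡ false → ¬ P
  false⇒ {P} eq p = contradiction (trans (sym (dec-true em₀ p)) eq) λ ()

  -- Clopen sets of a zero-dimensional Polish space

  module ClopenSets (Y : Space) where
    open Space Y
    open OpenSets Y

    clopen-≐ : ∀ {V W} → V ≐ W → Clopen Y V → Clopen Y W
    clopen-≐ V≐W (oV , o∁V) = open-≐ V≐W oV ,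
      open-≐ ((λ ∉V → ∉V ∘ proj₂ V≐W) , (λ ∉W → ∉W ∘ proj₁ V≐W)) o∁V

    clopen-∅ : Clopen Y ∅
    clopen-∅ = open-∅ , open-≐ ((λ _ ()) , _) open-U

    clopen-∁ : ∀ {V} → Clopen Y V → Clopen Y (∁ V)
    clopen-∁ (oV , o∁V) = o∁V , open-≐ ∁∁ oV

    clopen-U : Clopen Y U
    clopen-U = open-U , open-≐ ((λ ()) , (λ ∉U → ∉U _)) open-∅

    clopen-∪ : ∀ {V W} → Clopen Y V → Clopen Y W → Clopen Y (V ∪ W)
    clopen-∪ (oV , o∁V) (oW , o∁W) = open-∪ oV oW ,
      open-≐ ((λ (∉V , ∉W) → [ ∉V , ∉W ]′) , (λ ∉ → ∉ ∘ inj₁ , ∉ ∘ inj₂)) (open-∩ o∁V o∁W)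

    clopen-∩ : ∀ {V W} → Clopen Y V → Clopen Y W → Clopen Y (V ∩ W)
    clopen-∩ cV cW = clopen-≐
      ((λ ∉ → stable (∉ ∘ inj₁) , stable (∉ ∘ inj₂)) , (λ (v , w) → [ (λ ∉V → ∉V v) , (λ ∉W → ∉W w) ]′))
      (clopen-∁ (clopen-∪ (clopen-∁ cV) (clopen-∁ cW)))

    -- The family picks, for each rational ball around a point of a dense sequence,
    -- a clopen set between that ball and O whenever there is one.
    open⇒⋃clopen : Polish Y → ZeroDimensional Y → ∀ {O} → IsOpen O →
      Σ[ C ∈ (ℕ → Pred Carrier 0ℓ) ] (∀ n → Clopen Y (C n)) × O ≐ ⋃ ℕ C
    open⇒⋃clopen ((s , dense) , μ , _ , ind) zd {O} oO =
      C , C-clopen , O⊆⋃ , λ (n , x∈C) → C⊆O n x∈C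
      where
      open MetricSpaces Y μ ind
      open Metric μ

      Between : ℕ → ℚ → Set₁
      Between n q = Σ[ W ∈ Pred Carrier 0ℓ ] Clopen Y W × W ⊆ O ×
        (∀ {x} → s n ≡ just x → Ball x q ⊆ W)

      choose : ∀ n q → Dec (Between n q) → Pred Carrier 0ℓ
      choose n q (yes (W , _)) = W
      choose n q (no _) = ∅

      C : ℕ → Pred Carrier 0ℓ
      C t = let n , r = unpair t in choose n (fraction r) em

      C-clopen : ∀ t → Clopen Y (C t)
      C-clopen t with em {Between (proj₁ (unpair t)) (fraction (proj₂ (unpair t)))}
      ... | yes (_ , cW , _) = cW
      ... | no _ = clopen-∅

      C⊆O : ∀ t → C t ⊆ O
      C⊆O t x∈C with em {Between (proj₁ (unpair t)) (fraction (proj₂ (unpair t)))}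
      ... | yes (_ , _ , W⊆O , _) = W⊆O x∈C

      ball⊆C : ∀ {n q x} → Between n q → s n ≡ just x → (b : Dec (Between n q)) →
               Ball x q ⊆ choose n q b
      ball⊆C _ eq (yes (_ , _ , _ , ball⊆W)) = ball⊆W eq
      ball⊆C b _ (no ¬b) = contradiction b ¬b

      O⊆⋃ : O ⊆ ⋃ ℕ C
      O⊆⋃ {x} x∈O
        with W , cW , x∈W , W⊆O ← zd O oO x x∈O
        with ε , 0<ε , ball⊆W ← ballInside (proj₁ cW) x∈W
        -- The ball of radius `½ ℚ.* ε` around this point `y` of the dense sequence contains `x` and
        -- lies in the `ε`-ball around `x`, hence in `W`.
        with y , xy , n , eq ← dense {x} _ (Ball x (½ ℚ.* ε)) (ball-open x _) (d-refl x (half-positive 0<ε))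
        with r , e ← fraction-surjective (½ ℚ.* ε) (half-positive 0<ε)
        = pair n r , subst (λ (n , r) → x ∈ choose n (fraction r) em) (sym (unpair-pair n r))
            (ball⊆C (subst (Between n) (sym e) between) eq em
              (subst (d y x <ℚ_) (sym e) (proj₁ (d-sym y x) _ xy)))
        where
        between : Between n (½ ℚ.* ε)
        between = W , cW , W⊆O , λ {z} eq′ {w} zw →
          ball⊆W (subst (d x w <ℚ_) (half+half ε)
            (triangle xy (subst (λ u → d u w <ℚ _) (Maybeₚ.just-injective (trans (sym eq′) eq)) zw)))


    -- Clopen siftings of Gδ sets

    Sifting : Pred Carrier 0ℓ → Set₁
    Sifting G = Σ[ E ∈ (ℕ → ℕ → Pred Carrier 0ℓ) ]
      (∀ k j → Clopen Y (E k j)) ×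
      (∀ k i j {y} → y ∈ E k i → y ∈ E k j → i ≡ j) ×
      (∀ {y} → y ∈ G → ∀ k → ∃[ j ] y ∈ E k j) ×
      (∀ {y} → y ∉ G → ∃[ m ] ∀ k j → m ≤ k → y ∉ E k j)

    -- `E k j` says that `j` is the least bound below which the first `k` conditions all have
    -- witnesses. Least bounds are unique, and each row has one if all conditions hold. A condition
    -- `i` without a witness empties all rows from `suc i` on.
    ⋂⋃clopen⇒sifting : ∀ {G} (C : ℕ → ℕ → Pred Carrier 0ℓ) → (∀ i j → Clopen Y (C i j)) →
      G ≐ (λ y → ∀ i → ∃[ j ] y ∈ C i j) → Sifting G
    ⋂⋃clopen⇒sifting {G} C cC (G⊆ , ⊆G) = E , E-clopen , E-unique , E-exists , E-stops
      where
      R : ℕ → ℕ → Pred Carrier 0ℓ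
      R i zero = ∅
      R i (suc j) = R i j ∪ C i j

      P : ℕ → ℕ → Pred Carrier 0ℓ
      P zero j = U
      P (suc k) j = P k j ∩ R k j

      E : ℕ → ℕ → Pred Carrier 0ℓ
      E k zero = P k zero
      E k (suc j) = P k (suc j) ∩ ∁ (P k j)

      R-clopen : ∀ i j → Clopen Y (R i j)
      R-clopen i zero = clopen-∅
      R-clopen i (suc j) = clopen-∪ (R-clopen i j) (cC i j)

      P-clopen : ∀ k j → Clopen Y (P k j)
      P-clopen zero j = clopen-U
      P-clopen (suc k) j = clopen-∩ (P-clopen k j) (R-clopen k j)

      E-clopen : ∀ k j → Clopen Y (E k j)
      E-clopen k zero = P-clopen k zero
      E-clopen k (suc j) = clopen-∩ (P-clopen k (suc j)) (clopen-∁ (P-clopen k j))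

      R-mono : ∀ i {j j′} → j ℕ.≤′ j′ → R i j ⊆ R i j′
      R-mono i ℕ.≤′-refl y∈R = y∈R
      R-mono i (ℕ.≤′-step j≤j′) y∈R = inj₁ (R-mono i j≤j′ y∈R)

      P-mono : ∀ k {j j′} → j ≤ j′ → P k j ⊆ P k j′
      P-mono zero _ _ = _
      P-mono (suc k) j≤j′ (y∈P , y∈R) = P-mono k j≤j′ y∈P , R-mono k (ℕₚ.≤⇒≤′ j≤j′) y∈R

      P-anti : ∀ {k k′} j → k ℕ.≤′ k′ → P k′ j ⊆ P k j
      P-anti j ℕ.≤′-refl y∈P = y∈P
      P-anti j (ℕ.≤′-step k≤k′) (y∈P , _) = P-anti j k≤k′ y∈P

      E⊆P : ∀ k j → E k j ⊆ P k j
      E⊆P k zero y∈P = y∈P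
      E⊆P k (suc j) (y∈P , _) = y∈P

      E-≮ : ∀ k i j {y} → i < j → y ∈ E k i → y ∉ E k j
      E-≮ k i (suc j) (s≤s i≤j) y∈Ei (_ , y∉P) = y∉P (P-mono k i≤j (E⊆P k i y∈Ei))

      E-unique : ∀ k i j {y} → y ∈ E k i → y ∈ E k j → i ≡ j
      E-unique k i j y∈Ei y∈Ej with ℕₚ.<-cmp i j
      ... | tri< i<j _ _ = contradiction y∈Ej (E-≮ k i j i<j y∈Ei)
      ... | tri≈ _ i≡j _ = i≡j
      ... | tri> _ _ j<i = contradiction y∈Ei (E-≮ k j i j<i y∈Ej)

      P⇒E : ∀ k j {y} → y ∈ P k j → ∃[ i ] y ∈ E k i
      P⇒E k zero y∈P = zero , y∈P
      P⇒E k (suc j) {y} y∈P with em₀ {y ∈ P k j}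
      ... | yes y∈P′ = P⇒E k j y∈P′
      ... | no y∉P′ = suc j , y∈P , y∉P′

      P-exists : ∀ {y} → y ∈ G → ∀ k → ∃[ j ] y ∈ P k j
      P-exists y∈G zero = 0 , _
      P-exists y∈G (suc k) =
        let j , y∈P = P-exists y∈G k
            i , y∈C = G⊆ y∈G k
        -- `suc i`, since `R k` collects only the witnesses strictly below its bound.
        in j ⊔ suc i , P-mono k (ℕₚ.m≤m⊔n j (suc i)) y∈P ,
           R-mono k (ℕₚ.≤⇒≤′ (ℕₚ.m≤n⊔m j (suc i))) (inj₂ y∈C)

      E-exists : ∀ {y} → y ∈ G → ∀ k → ∃[ j ] y ∈ E k j
      E-exists y∈G k = let j , y∈P = P-exists y∈G k in P⇒E k j y∈P

      R⇒C : ∀ i j {y} → y ∈ R i j → ∃[ j ] y ∈ C i j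
      R⇒C i (suc j) (inj₁ y∈R) = R⇒C i j y∈R
      R⇒C i (suc j) (inj₂ y∈C) = j , y∈C

      E-stops : ∀ {y} → y ∉ G → ∃[ m ] ∀ k j → m ≤ k → y ∉ E k j
      E-stops {y} y∉G = stable λ none → y∉G (⊆G λ i → stable λ empty →
        none (suc i , λ k j i<k y∈E →
          empty (R⇒C i j (proj₂ (P-anti j (ℕₚ.≤⇒≤′ i<k) (E⊆P k j y∈E))))))

    module _ (polish : Polish Y) (zd : ZeroDimensional Y) where

      -- A closed set is already an intersection of clopen sets, so each inner union is that of a
      -- constant family.
      Π⁰₁⇒sifting : ∀ {G} → Π⁰ Y 1 G → Sifting G
      Π⁰₁⇒sifting (complement O (isOpen oO) (G⊆ , ⊆G)) =
        let C , cC , O⊆ , ⊆O = open⇒⋃clopen polish zd oO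
        in ⋂⋃clopen⇒sifting (λ i _ → ∁ (C i)) (λ i _ → clopen-∁ (cC i))
             ((λ y∈G i → 0 , λ y∈C → G⊆ y∈G (⊆O (i , y∈C))) ,
              λ f → ⊆G λ y∈O → let i , y∈C = O⊆ y∈O in proj₂ (f i) y∈C)
      Π⁰₁⇒sifting (complement _ (union (s≤s ()) _ _ _) _)

      Π⁰₁⇒closed : ∀ {β G} → β < 2 → Π⁰ Y β G → IsOpen (∁ G)
      Π⁰₁⇒closed _ (complement O (isOpen oO) (G⊆ , ⊆G)) =
        open-≐ ((λ y∈O y∈G → G⊆ y∈G y∈O) , λ y∉G → stable (y∉G ∘ ⊆G)) oO
      Π⁰₁⇒closed β<2 (complement _ (union 2≤β _ _ _) _) =
        contradiction 2≤β (ℕₚ.<⇒≱ β<2)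

      Π⁰₂⇒sifting : ∀ {G} → Π⁰ Y 2 G → Sifting G
      Π⁰₂⇒sifting (complement S (union _ F F∈Π S≐) (G⊆ , ⊆G)) =
        ⋂⋃clopen⇒sifting (λ i → proj₁ (cover i)) (λ i → proj₁ (proj₂ (cover i)))
          ((λ y∈G i → proj₁ (proj₂ (proj₂ (cover i))) λ y∈F → G⊆ y∈G (proj₂ S≐ (i , y∈F))) ,
           λ f → ⊆G λ y∈S → let i , y∈F = proj₁ S≐ y∈S in
             proj₂ (proj₂ (proj₂ (cover i))) (f i) y∈F)
        where
        cover : ∀ i → Σ[ C ∈ (ℕ → Pred Carrier 0ℓ) ] (∀ n → Clopen Y (C n)) × ∁ (F i) ≐ ⋃ ℕ C
        cover i = let β , β<2 , Fi∈Π = F∈Π i in open⇒⋃clopen polish zd (Π⁰₁⇒closed β<2 Fi∈Π)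

      Π⁰⇒sifting : ∀ {β G} → β < 3 → Π⁰ Y β G → Sifting G
      Π⁰⇒sifting {0} _ (complement _ (union () _ _ _) _)
      Π⁰⇒sifting {1} _ G∈Π = Π⁰₁⇒sifting G∈Π
      Π⁰⇒sifting {2} _ G∈Π = Π⁰₂⇒sifting G∈Π
      Π⁰⇒sifting {suc (suc (suc _))} (s≤s (s≤s (s≤s ())))

  -- Closed and Fσ conditions on subsets

  module Powerset (X : Space) where
    open Space X

    Constant : Pred Carrier 0ℓ → Pred (Subset X) 0ℓ
    Constant V A = ∀ {x y} → x ∈ V → y ∈ V → A ⟨$⟩ x ≡ A ⟨$⟩ y

    MixedOn : (Carrier → Carrier → Set) → Pred (Subset X) 0ℓ
    MixedOn R A = ∃[ x ] ∃[ y ] (R x y × A ⟨$⟩ x ≢ A ⟨$⟩ y)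

    -- A violation is visible on two coordinates, and every set in the box fixing them shares it.
    mixed-open : ∀ R → 𝒫-IsOpen X (MixedOn R)
    mixed-open R A (x , y , r , Ax≢Ay) =
      (x , A ⟨$⟩ x) ∷ (y , A ⟨$⟩ y) ∷ [] ,
      (λ { (here refl) → refl ; (there (here refl)) → refl }) ,
      λ B∈ → x , y , r , λ Bx≡By → Ax≢Ay (trans (sym (B∈ (here refl))) (trans Bx≡By (B∈ (there (here refl)))))

    Closed : Pred (Subset X) 0ℓ → Set
    Closed F = 𝒫-IsOpen X (∁ F)

    Invariant : (Carrier → Carrier → Set) → Pred (Subset X) 0ℓ
    Invariant R A = ∀ x y → R x y → A ⟨$⟩ x ≡ A ⟨$⟩ y

    invariant-closed : ∀ R → Closed (Invariant R)
    invariant-closed R = Space.open-≐ (𝒫 X)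
      ((λ (x , y , r , ne) inv → ne (inv x y r)) ,
       λ {A} ¬inv → stable λ none → ¬inv λ x y r →
         decidable-stable (A ⟨$⟩ x Boolₚ.≟ A ⟨$⟩ y) λ ne → none (x , y , r , ne))
      (mixed-open R)

    closed-≐ : ∀ {F G} → F ≐ G → Closed F → Closed G
    closed-≐ F≐G = Space.open-≐ (𝒫 X)
      ((λ ∉F → ∉F ∘ proj₂ F≐G) , (λ ∉G → ∉G ∘ proj₁ F≐G))

    constant-closed : ∀ V → Closed (Constant V)
    constant-closed V = closed-≐ {Invariant λ x y → x ∈ V × y ∈ V} {Constant V}
      ((λ inv x∈V y∈V → inv _ _ (x∈V , y∈V)) , λ const _ _ (x∈V , y∈V) → const x∈V y∈V)
      (invariant-closed (λ x y → x ∈ V × y ∈ V))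

    closed-∩ : ∀ {F G} → Closed F → Closed G → Closed (F ∩ G)
    closed-∩ cF cG = Space.open-≐ (𝒫 X)
      ([ (λ ∉F → ∉F ∘ proj₁) , (λ ∉G → ∉G ∘ proj₂) ]′ ,
       λ {A} ∉ → stable λ none → ∉ (stable (none ∘ inj₁) , stable (none ∘ inj₂)))
      (OpenSets.open-∪ (𝒫 X) cF cG)

    closed-const : ∀ (S : Set) → Closed (λ _ → S)
    closed-const S A ¬S = [] , (λ ()) , λ _ → ¬S

    Fσ : ∀ {ℓ} → Pred (Subset X) ℓ → Set _
    Fσ P = Σ[ F ∈ (ℕ → Pred (Subset X) 0ℓ) ] (∀ n → Closed (F n)) × P ≐ ⋃ ℕ F

    Fσ-≐ : ∀ {a b} {P : Pred (Subset X) a} {Q : Pred (Subset X) b} → P ≐ Q → Fσ P → Fσ Q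
    Fσ-≐ (P⊆Q , Q⊆P) (F , cF , P⊆ , ⊆P) = F , cF ,
      (λ {A} q → P⊆ {A} (Q⊆P {A} q)) , (λ {A} f → P⊆Q {A} (⊆P {A} f))

    Fσ-closed : ∀ {F} → Closed F → Fσ F
    Fσ-closed {F} cF = (λ _ → F) , (λ _ → cF) , (0 ,_) , proj₂

    Fσ-∩ : ∀ {a b} {P : Pred (Subset X) a} {Q : Pred (Subset X) b} → Fσ P → Fσ Q → Fσ (P ∩ Q)
    Fσ-∩ {P = P} {Q} (F , cF , P⊆ , ⊆P) (G , cG , Q⊆ , ⊆Q) =
      (λ t → F (proj₁ (unpair t)) ∩ G (proj₂ (unpair t))) ,
      (λ t → closed-∩ {F (proj₁ (unpair t))} {G (proj₂ (unpair t))} (cF _) (cG _)) ,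
      (λ {A} (p , q) → let m , f = P⊆ {A} p ; n , g = Q⊆ {A} q in
        pair m n , subst (λ (m , n) → A ∈ F m × A ∈ G n) (sym (unpair-pair m n)) (f , g)) ,
      (λ {A} (t , f , g) → ⊆P {A} (_ , f) , ⊆Q {A} (_ , g))

    Fσ-⇒ : ∀ {ℓ} (S : Set) {P : Pred (Subset X) ℓ} → Fσ P → Fσ (λ A → S → A ∈ P)
    Fσ-⇒ S (F , cF , P⊆ , ⊆P) with em₀ {S}
    ... | yes s = F , cF , (λ {A} p → P⊆ {A} (p s)) , λ {A} f _ → ⊆P {A} f
    -- The condition is vacuous here; `S → S` describes the whole powerset in a form covered by
    -- `closed-const`.
    ... | no ¬s = (λ _ _ → S → S) , (λ _ → closed-const (S → S)) ,
                  (λ _ → 0 , id) , λ _ s → contradiction s ¬s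

    closed⇒Π⁰₁ : ∀ {F} → Closed F → Π⁰ (𝒫 X) 1 F
    closed⇒Π⁰₁ {F} cF = complement (∁ F) (isOpen cF) ∁∁

    Fσ⇒Σ⁰₂ : ∀ {P} → Fσ P → Σ⁰ (𝒫 X) 2 P
    Fσ⇒Σ⁰₂ (F , cF , P≐) = union ℕₚ.≤-refl F (λ n → 1 , ℕₚ.≤-refl , closed⇒Π⁰₁ (cF n)) P≐

    Fσ⇒InClass : ∀ {ℓ} {P : Pred (Subset X) ℓ} → Fσ P → InClass (𝚺⁰ 2) (𝒫 X) P
    Fσ⇒InClass (F , cF , P≐) = ⋃ ℕ F , P≐ , Fσ⇒Σ⁰₂ (F , cF , id , id)

    -- Monitorability in terms of constant parts

    HasConstantPart : Pred Carrier 0ℓ → Pred (Subset X) (lsuc 0ℓ)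
    HasConstantPart W A = Σ[ V ∈ Pred Carrier 0ℓ ] NonEmptyOpen X V × V ⊆ W × A ∈ Constant V

    MonitorableIn : Pred Carrier 0ℓ → Pred (Subset X) (lsuc 0ℓ)
    MonitorableIn S A = ∀ W → NonEmptyOpen X W → W ⊆ S → A ∈ HasConstantPart W

    neo-∩ : ∀ {V W x} → IsOpen V → IsOpen W → x ∈ V → x ∈ W → NonEmptyOpen X (V ∩ W)
    neo-∩ oV oW x∈V x∈W = open-∩ oV oW , _ , x∈V , x∈W

    constant-⊆ : ∀ {V W} (A : Subset X) → V ⊆ W → A ∈ Constant W → A ∈ Constant V
    constant-⊆ A V⊆W const x∈V y∈V = const (V⊆W x∈V) (V⊆W y∈V)

    ¬DenseIn⇒ : ∀ {V} {S : Pred Carrier 0ℓ} → IsOpen V → ¬ DenseIn X S V →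
      Σ[ V′ ∈ Pred Carrier 0ℓ ] NonEmptyOpen X V′ × V′ ⊆ V × V′ ⊆ ∁ S
    ¬DenseIn⇒ {V} {S} oV ¬dense = stable-∃ (λ V′ → NonEmptyOpen X V′ × V′ ⊆ V × V′ ⊆ ∁ S) λ none →
      ¬dense λ {x} x∈V V′ oV′ x∈V′ → stable λ V′≬̸S →
        none (V′ ∩ V) (neo-∩ oV′ oV x∈V′ x∈V , proj₂ , λ (z∈V′ , _) z∈S → V′≬̸S (_ , z∈V′ , z∈S))

    constant-from : ∀ {V} (A : Subset X) b → (∀ {x} → x ∈ V → A ⟨$⟩ x ≡ b) → A ∈ Constant V
    constant-from A b eq x∈V y∈V = trans (eq x∈V) (sym (eq y∈V))

    -- Where density fails there is an open part on which `A` is false throughout; where codensity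
    -- fails, one on which it is true throughout. Conversely, the value on a constant part of `W`
    -- decides which of the two fails in `W`.
    monitorable≐ : Monitorable X ≐ MonitorableIn U
    monitorable≐ = (λ {A} → ⇒ A) , (λ {A} → ⇐ A)
      where
      ⇒ : ∀ A → A ∈ Monitorable X → A ∈ MonitorableIn U
      ⇒ A mon W neo@(oW , _) _ with mon W neo
      ... | inj₁ ¬dense = let V , neoV , V⊆W , V⊆∁A = ¬DenseIn⇒ oW ¬dense in
        V , neoV , V⊆W , constant-from {V} A false λ x∈V → Boolₚ.¬-not (V⊆∁A x∈V)
      ... | inj₂ ¬codense = let V , neoV , V⊆W , V⊆∁∁A = ¬DenseIn⇒ oW ¬codense in
        V , neoV , V⊆W , constant-from {V} A true λ x∈V → stable (V⊆∁∁A x∈V)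
      ⇐ : ∀ A → A ∈ MonitorableIn U → A ∈ Monitorable X
      ⇐ A mon W neo with mon W neo _
      ... | V , (oV , p , p∈V) , V⊆W , const with A ⟨$⟩ p in eq
      ...   | true = inj₂ λ codense → let z , z∈V , z∉A = codense (V⊆W p∈V) V oV p∈V in
                z∉A (trans (const z∈V p∈V) eq)
      ...   | false = inj₁ λ dense → let z , z∈V , z∈A = dense (V⊆W p∈V) V oV p∈V in
                contradiction (trans (sym z∈A) (trans (const z∈V p∈V) eq)) λ ()

    monitorableIn-⊆ : ∀ {S T} (A : Subset X) → S ⊆ T → A ∈ MonitorableIn T → A ∈ MonitorableIn S
    monitorableIn-⊆ A S⊆T mon W neo W⊆S = mon W neo (S⊆T ∘ W⊆S)

    -- Otherwise `W` would be minimal and its points would lie in `H X`.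
    ¬minimal⇒smaller : ∀ {W} → NonEmptyOpen X W → W ⊆ ∁ (H X) →
      Σ[ W′ ∈ Pred Carrier 0ℓ ] NonEmptyOpen X W′ × W′ ⊆ W × ∃[ x ] (x ∈ W × x ∉ W′)
    ¬minimal⇒smaller {W} neo@(_ , _ , w∈W) W⊆∁H = stable-∃
      (λ W′ → NonEmptyOpen X W′ × W′ ⊆ W × ∃[ x ] (x ∈ W × x ∉ W′)) λ none →
      W⊆∁H w∈W (W , (neo , λ W′ neo′ W′⊆W → W′⊆W ,
        λ x∈W → stable λ x∉W′ → none W′ (neo′ , W′⊆W , _ , x∈W , x∉W′)) , w∈W)

    -- Borel upper bounds from a countable base

    module _ (B : ℕ → Pred Carrier 0ℓ) (oB : ∀ n → IsOpen (B n))
      (base : ∀ V → IsOpen V → ∀ x → x ∈ V → ∃[ n ] (x ∈ B n × B n ⊆ V)) where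

      -- A constant part shrinks to a non-empty basic set, which leaves countably many closed
      -- conditions. The guard `Satisfiable W` keeps the condition true for empty members of the
      -- base.
      hasConstantPart-Fσ : ∀ W → Fσ (λ A → Satisfiable W → A ∈ HasConstantPart W)
      hasConstantPart-Fσ W = Fσ-⇒ (Satisfiable W) {HasConstantPart W}
        ((λ n A → (Satisfiable (B n) × B n ⊆ W) × A ∈ Constant (B n)) ,
         (λ n → closed-∩ {λ _ → Satisfiable (B n) × B n ⊆ W} {Constant (B n)}
                  (closed-const _) (constant-closed (B n))) ,
         (λ {A} (V , (oV , p , p∈V) , V⊆W , const) →
           let n , p∈Bn , Bn⊆V = base V oV p p∈V in
           n , ((p , p∈Bn) , V⊆W ∘ Bn⊆V) , constant-⊆ {B n} A Bn⊆V const) ,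
         λ (n , (sat , Bn⊆W) , const) → B n , (oB n , sat) , Bn⊆W , const)

      monitorable-Π⁰₃ : InClass (𝚷⁰ 3) (𝒫 X) (Monitorable X)
      monitorable-Π⁰₃ = M , ((λ {A} → ⇒ A) , (λ {A} → ⇐ A)) ,
        complement (⋃ ℕ λ n → ∁ (⋃ ℕ (F n)))
          (union (s≤s (s≤s z≤n)) (λ n → ∁ (⋃ ℕ (F n)))
            (λ n → 2 , ℕₚ.≤-refl , complement (⋃ ℕ (F n))
              (Fσ⇒Σ⁰₂ (F n , proj₁ (proj₂ (hasConstantPart-Fσ (B n))) , id , id)) (id , id))
            (id , id))
          ((λ m (n , ∉F) → ∉F (m n)) , λ ∉ n → stable λ ∉F → ∉ (n , ∉F))
        where
        F : ℕ → ℕ → Pred (Subset X) 0ℓ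
        F n = proj₁ (hasConstantPart-Fσ (B n))

        -- The small predicate that `InClass` asks for: testing the basic sets suffices, since every
        -- non-empty open set contains a non-empty one of them.
        M : Pred (Subset X) 0ℓ
        M A = ∀ n → A ∈ ⋃ ℕ (F n)

        F≐ : ∀ n → (λ A → Satisfiable (B n) → A ∈ HasConstantPart (B n)) ≐ ⋃ ℕ (F n)
        F≐ n = proj₂ (proj₂ (hasConstantPart-Fσ (B n)))

        ⇒ : ∀ A → A ∈ Monitorable X → A ∈ M
        ⇒ A mon n = proj₁ (F≐ n) {A} λ sat → proj₁ monitorable≐ {A} mon (B n) (oB n , sat) _

        ⇐ : ∀ A → A ∈ M → A ∈ Monitorable X
        ⇐ A m = proj₂ monitorable≐ {A} λ W (oW , w , w∈W) _ →
          let n , w∈Bn , Bn⊆W = base W oW w w∈W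
              V , neoV , V⊆Bn , const = proj₂ (F≐ n) {A} (m n) (w , w∈Bn)
          in V , neoV , Bn⊆W ∘ V⊆Bn , const

      -- A region whose monitorability condition is not Fσ is reducible, and in any
      -- splitting of it into disjoint open sets whose union is dense, one piece
      -- inherits the defect.
      ¬Fσ-splits : ∀ {S} → IsOpen S → ¬ Fσ (MonitorableIn S) →
        Σ[ Z ∈ Pred Carrier 0ℓ ] Σ[ S′ ∈ Pred Carrier 0ℓ ]
          NonEmptyOpen X Z × IsOpen S′ × ¬ Fσ (MonitorableIn S′) ×
          Z ⊆ S × S′ ⊆ S × ¬ (Z ≬ S′)
      ¬Fσ-splits {S} oS ¬fσ
        with em {Σ[ V ∈ Pred Carrier 0ℓ ] Σ[ W ∈ Pred Carrier 0ℓ ]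
                 NonEmptyOpen X V × NonEmptyOpen X W × V ⊆ S × W ⊆ S × ¬ (V ≬ W)}
      -- Here a single constant part `V` of `S` suffices: every non-empty open `W` inside `S` meets
      -- `V`, and `A` is constant on `V ∩ W`.
      ... | no irreducible = contradiction
        (Fσ-≐ ((λ {A} → ⇐ A) , λ {A} mon (s , s∈S) → mon S (oS , s , s∈S) id)
          (hasConstantPart-Fσ S)) ¬fσ
        where
        ⇐ : ∀ A → (Satisfiable S → A ∈ HasConstantPart S) → A ∈ MonitorableIn S
        ⇐ A part W neo@(oW , w , w∈W) W⊆S =
          let V , neoV@(oV , _) , V⊆S , const = part (w , W⊆S w∈W)
              x , x∈V , x∈W = stable λ V≬̸W → irreducible (V , W , neoV , neo , V⊆S , W⊆S , V≬̸W)
          in V ∩ W , neo-∩ oV oW x∈V x∈W , proj₂ , constant-⊆ {V ∩ W} A proj₁ const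
      ... | yes (V , W , neoV@(oV , _) , (oW , w , w∈W) , V⊆S , W⊆S , V≬̸W)
        with em {Fσ (MonitorableIn V)}
      ...   | no ¬fσV = W , V , (oW , w , w∈W) , oV , ¬fσV , W⊆S , V⊆S ,
              λ (x , x∈W , x∈V) → V≬̸W (x , x∈V , x∈W)
      ...   | yes fσV = V , V⊥ , neoV , oV⊥ ,
              (λ fσV⊥ → ¬fσ (Fσ-≐ ((λ {A} → glue A) , λ {A} → split A) (Fσ-∩ fσV fσV⊥))) ,
              V⊆S , (λ ((_ , Bn⊆S , _) , x∈Bn) → Bn⊆S x∈Bn) ,
              λ (x , x∈V , (n , _ , V≬̸Bn) , x∈Bn) → V≬̸Bn (x , x∈V , x∈Bn)
        where
        -- The largest open subset of `S` disjoint from `V`, built from basic sets to keep the index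
        -- type small. An open part of `S` that misses `V` lies inside it.
        V⊥ : Pred Carrier 0ℓ
        V⊥ = ⋃ (∃[ n ] (B n ⊆ S × ¬ (V ≬ B n))) (λ (n , _) → B n)
        oV⊥ : IsOpen V⊥
        oV⊥ = open-⋃ _ _ (λ (n , _) → oB n)
        split : ∀ A → A ∈ MonitorableIn S → A ∈ MonitorableIn V × A ∈ MonitorableIn V⊥
        split A mon = monitorableIn-⊆ {V} A V⊆S mon ,
          monitorableIn-⊆ {V⊥} A (λ ((_ , Bn⊆S , _) , x∈Bn) → Bn⊆S x∈Bn) mon
        glue : ∀ A → A ∈ MonitorableIn V × A ∈ MonitorableIn V⊥ → A ∈ MonitorableIn S
        glue A (monV , monV⊥) W′ neo@(oW′ , _) W′⊆S with em₀ {V ≬ W′}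
        ... | yes (x , x∈V , x∈W′) =
          let P , neoP , P⊆ , const = monV (V ∩ W′) (neo-∩ oV oW′ x∈V x∈W′) proj₁
          in P , neoP , proj₂ ∘ P⊆ , const
        ... | no V≬̸W′ = monV⊥ W′ neo λ {x} x∈W′ →
          let n , x∈Bn , Bn⊆W′ = base W′ oW′ x x∈W′
          in (n , W′⊆S ∘ Bn⊆W′ , λ (z , z∈V , z∈Bn) → V≬̸W′ (z , z∈V , Bn⊆W′ z∈Bn)) , x∈Bn

      -- The splitting is iterated: `Z n` is set aside and the other piece, whose condition is again
      -- not Fσ, is split next. All later pieces lie in that other piece, hence are disjoint from
      -- `Z n`.
      ¬Fσ⇒infinitelyMany : ∀ {S} → IsOpen S → ¬ Fσ (MonitorableIn S) → InfinitelyManyDisjointOpensIn X S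
      ¬Fσ⇒infinitelyMany {S} oS ¬fσ = (λ n → Z n) , (λ n → proj₁ (neoZ n)) ,
        (λ n → region-⊆ {0} {n} (ℕₚ.≤⇒≤′ z≤n) ∘ Z⊆ n) ,
        (λ m n m≢n Zm≐Zn → let _ , z , z∈ = neoZ m in disjoint m n m≢n (z , z∈ , proj₁ Zm≐Zn z∈)) ,
        disjoint
        where
        Region : Set₁
        Region = Σ[ T ∈ Pred Carrier 0ℓ ] IsOpen T × ¬ Fσ (MonitorableIn T)

        region : ℕ → Region
        region zero = S , oS , ¬fσ
        region (suc n) = let _ , oT , ¬fσT = region n
                             _ , T′ , _ , oT′ , ¬fσT′ , _ = ¬Fσ-splits oT ¬fσT
                         in T′ , oT′ , ¬fσT′

        splitting : ∀ n → _
        splitting n = ¬Fσ-splits (proj₁ (proj₂ (region n))) (proj₂ (proj₂ (region n)))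

        Z : ℕ → Pred Carrier 0ℓ
        Z n = proj₁ (splitting n)

        neoZ : ∀ n → NonEmptyOpen X (Z n)
        neoZ n = let _ , _ , neo , _ = splitting n in neo

        Z⊆ : ∀ n → Z n ⊆ proj₁ (region n)
        Z⊆ n = let _ , _ , _ , _ , _ , Z⊆T , _ = splitting n in Z⊆T

        region-⊆ : ∀ {m n} → m ℕ.≤′ n → proj₁ (region n) ⊆ proj₁ (region m)
        region-⊆ ℕ.≤′-refl x∈ = x∈
        region-⊆ (ℕ.≤′-step {n} m≤n) x∈ =
          let _ , _ , _ , _ , _ , _ , T′⊆T , _ = splitting n in region-⊆ m≤n (T′⊆T x∈)

        disjoint-< : ∀ {m n} → m < n → ¬ (Z m ≬ Z n)
        disjoint-< {m} {n} m<n (x , x∈Zm , x∈Zn) =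
          let _ , _ , _ , _ , _ , _ , _ , Z≬̸T′ = splitting m
          in Z≬̸T′ (x , x∈Zm , region-⊆ (ℕₚ.≤⇒≤′ m<n) (Z⊆ n x∈Zn))

        disjoint : ∀ m n → m ≢ n → ¬ (Z m ≬ Z n)
        disjoint m n m≢n (x , x∈m , x∈n) with ℕₚ.<-cmp m n
        ... | tri< m<n _ _ = disjoint-< m<n (x , x∈m , x∈n)
        ... | tri≈ _ m≡n _ = m≢n m≡n
        ... | tri> _ _ n<m = disjoint-< n<m (x , x∈n , x∈m)

      -- The set `L X` as a small predicate, namely the union of the basic sets that avoid `H X`.
      L₀ : Pred Carrier 0ℓ
      L₀ = ⋃ (∃[ n ] Small (B n ⊆ ∁ (H X))) (λ (n , _) → B n)

      L₀⊆∁H : L₀ ⊆ ∁ (H X)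
      L₀⊆∁H ((n , Bn⊆) , x∈Bn) = toWitness Bn⊆ x∈Bn

      ⊆L₀ : ∀ {W} → IsOpen W → W ⊆ ∁ (H X) → W ⊆ L₀
      ⊆L₀ oW W⊆ {x} x∈W = let n , x∈Bn , Bn⊆W = base _ oW x x∈W in
        (n , fromWitness λ {z} z∈Bn → W⊆ (Bn⊆W z∈Bn)) , x∈Bn

      -- Invariance under this relation is constancy on every minimal open set, gathered into one
      -- closed condition.
      _∼_ : Carrier → Carrier → Set
      x ∼ y = Small (Σ[ V ∈ Pred Carrier 0ℓ ] MinimalOpen X V × x ∈ V × y ∈ V)

      -- A constant part of a minimal open set is all of it. Conversely, a non-empty open `W` either
      -- meets a minimal open `V`, and `A` is constant on `W ∩ V`, or it lies inside `L₀`.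
      monitorable≐∩ : Invariant _∼_ ∩ MonitorableIn L₀ ≐ Monitorable X
      monitorable≐∩ = (λ {A} → ⇒ A) , (λ {A} → ⇐ A)
        where
        ⇐ : ∀ A → A ∈ Monitorable X → A ∈ Invariant _∼_ × A ∈ MonitorableIn L₀
        ⇐ A mon = (λ x y x∼y →
            let V , (neo , minimal) , x∈V , y∈V = toWitness x∼y
                W , neoW , W⊆V , const = mon′ V neo _
                V⊆W = proj₂ (minimal W neoW W⊆V)
            in const (V⊆W x∈V) (V⊆W y∈V)) ,
          monitorableIn-⊆ {L₀} A _ mon′
          where
          mon′ : A ∈ MonitorableIn U
          mon′ = proj₁ monitorable≐ {A} mon

        ⇒ : ∀ A → A ∈ Invariant _∼_ × A ∈ MonitorableIn L₀ → A ∈ Monitorable X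
        ⇒ A (inv , mon) = proj₂ monitorable≐ {A} λ W neo@(oW , _) _ →
          stable-∃ (λ V → NonEmptyOpen X V × V ⊆ W × A ∈ Constant V) λ none →
            let V , part = mon W neo (⊆L₀ oW λ {x} x∈W (V , min@((oV , _) , _) , x∈V) →
                  none (W ∩ V) (neo-∩ oW oV x∈W x∈V , proj₁ ,
                    λ (_ , x∈V) (_ , y∈V) → inv _ _ (fromWitness (V , min , x∈V , y∈V))))
            in none V part

      monitorable-Σ⁰₂ : ¬ InfinitelyManyDisjointOpensIn X (∁ (H X)) → InClass (𝚺⁰ 2) (𝒫 X) (Monitorable X)
      monitorable-Σ⁰₂ ¬inf = Fσ⇒InClass (Fσ-≐ monitorable≐∩
        (Fσ-∩ (Fσ-closed (invariant-closed _∼_)) (decidable-stable em λ ¬fσ →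
          let V , oV , V⊆L₀ , distinct , disjoint = ¬Fσ⇒infinitelyMany (open-⋃ _ _ (λ (n , _) → oB n)) ¬fσ
          in ¬inf (V , oV , (λ n {x} x∈V → L₀⊆∁H (V⊆L₀ n x∈V)) , distinct , disjoint))))

    -- Nowhere dense sets and thin points

    NowhereDense : Pred Carrier 0ℓ → Set₁
    NowhereDense P = ∀ W → NonEmptyOpen X W →
      Σ[ V ∈ Pred Carrier 0ℓ ] NonEmptyOpen X V × V ⊆ W × V ⊆ ∁ P

    nowhereDense-⊆ : ∀ {P Q} → P ⊆ Q → NowhereDense Q → NowhereDense P
    nowhereDense-⊆ P⊆Q nd W neo = let V , neoV , V⊆W , V⊆∁Q = nd W neo
                                  in V , neoV , V⊆W , λ x∈V x∈P → V⊆∁Q x∈V (P⊆Q x∈P)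

    nowhereDense-∅ : NowhereDense ∅
    nowhereDense-∅ W neo = W , neo , id , λ _ ()

    nowhereDense-∪ : ∀ {P Q} → NowhereDense P → NowhereDense Q → NowhereDense (P ∪ Q)
    nowhereDense-∪ ndP ndQ W neo =
      let V , neoV , V⊆W , V⊆∁P = ndP W neo
          V′ , neoV′ , V′⊆V , V′⊆∁Q = ndQ V neoV
      in V′ , neoV′ , V⊆W ∘ V′⊆V , λ x∈V′ → [ V⊆∁P (V′⊆V x∈V′) , V′⊆∁Q x∈V′ ]′

    Thin : Carrier → Set₁
    Thin x = NowhereDense (_≈ x)

    -- If x ∈ W is not thin, it lies in every non-empty open subset of some G, and
    -- then any point of W ∩ G outside a smaller open set is thin, because x gives
    -- every neighbourhood of it a point in common with that smaller set.
    thinPoint : ∀ {W} → NonEmptyOpen X W → W ⊆ ∁ (H X) → ∃[ x ] (x ∈ W × Thin x)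
    thinPoint {W} (oW , x , x∈W) W⊆∁H
      with em {Σ[ G ∈ Pred Carrier 0ℓ ] NonEmptyOpen X G × (∀ V → NonEmptyOpen X V → V ⊆ G → x ∈ V)}
    ... | no ¬generic = x , x∈W , λ G neo →
      stable-∃ (λ V → NonEmptyOpen X V × V ⊆ G × V ⊆ ∁ (_≈ x)) λ none →
        ¬generic (G , neo , λ V neoV@(oV , _) V⊆G → stable λ x∉V →
          none V (neoV , V⊆G , λ z∈V z≈x → x∉V (open-resp oV z≈x z∈V)))
    ... | yes (G , neoG@(oG , _) , generic)
      with V , (oV , v) , V⊆WG , y , (y∈W , y∈G) , y∉V ←
        ¬minimal⇒smaller (neo-∩ oW oG x∈W (generic G neoG id)) (W⊆∁H ∘ proj₁)
      = y , y∈W , λ O neo@(oO , _) → avoid O neo em₀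
      where
      x∈V : x ∈ V
      x∈V = generic V (oV , v) (proj₂ ∘ V⊆WG)
      avoid : ∀ O → NonEmptyOpen X O → Dec (y ∈ O) →
        Σ[ V ∈ Pred Carrier 0ℓ ] NonEmptyOpen X V × V ⊆ O × V ⊆ ∁ (_≈ y)
      avoid O neo@(oO , _) (no y∉O) = O , neo , id , λ z∈O z≈y → y∉O (open-resp oO z≈y z∈O)
      avoid O neo@(oO , _) (yes y∈O) =
        O ∩ V , neo-∩ oO oV x∈O x∈V , proj₁ , λ (_ , z∈V) z≈y → y∉V (open-resp oV z≈y z∈V)
        where
        x∈O : x ∈ O
        x∈O = proj₁ (generic (O ∩ G) (neo-∩ oO oG y∈O y∈G) proj₂)

    -- The thin points chosen so far form a nowhere dense set, so `W t` has a non-empty open part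
    -- free of them, and the next point is taken there.
    thinPoints : (W : ℕ → Pred Carrier 0ℓ) → (∀ t → NonEmptyOpen X (W t)) → (∀ t → W t ⊆ ∁ (H X)) →
      Σ[ a ∈ (ℕ → Carrier) ] (∀ t → a t ∈ W t) × (∀ t → Thin (a t)) × (∀ s t → a s ≈ a t → s ≡ t)
    thinPoints W neoW W⊆∁H = a , a∈W , a-thin , a-injective
      where
      pick : ∀ t {P} → NowhereDense P → ∃[ x ] ((x ∈ W t × x ∉ P) × Thin x)
      pick t nd = let V , neoV , V⊆W , V⊆∁P = nd (W t) (neoW t)
                      x , x∈V , thin = thinPoint neoV (W⊆∁H t ∘ V⊆W)
                  in x , (V⊆W x∈V , V⊆∁P x∈V) , thin

      used : ℕ → Σ[ P ∈ Pred Carrier 0ℓ ] NowhereDense P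
      used zero = ∅ , nowhereDense-∅
      used (suc t) = let P , nd = used t ; x , _ , thin = pick t nd
                     in P ∪ (_≈ x) , nowhereDense-∪ nd thin

      a : ℕ → Carrier
      a t = proj₁ (pick t (proj₂ (used t)))

      a∈W : ∀ t → a t ∈ W t
      a∈W t = proj₁ (proj₁ (proj₂ (pick t (proj₂ (used t)))))

      a-new : ∀ t → a t ∉ proj₁ (used t)
      a-new t = proj₂ (proj₁ (proj₂ (pick t (proj₂ (used t)))))

      a-thin : ∀ t → Thin (a t)
      a-thin t = proj₂ (proj₂ (pick t (proj₂ (used t))))

      a-used : ∀ {s t x} → suc s ℕ.≤′ t → x ≈ a s → x ∈ proj₁ (used t)
      a-used ℕ.≤′-refl x≈ = inj₂ x≈
      a-used (ℕ.≤′-step s<t) x≈ = inj₁ (a-used s<t x≈)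

      a-injective : ∀ s t → a s ≈ a t → s ≡ t
      a-injective s t eq with ℕₚ.<-cmp s t
      ... | tri< s<t _ _ = contradiction (a-used (ℕₚ.≤⇒≤′ s<t) (≈-sym eq)) (a-new t)
      ... | tri≈ _ s≡t _ = s≡t
      ... | tri> _ _ t<s = contradiction (a-used (ℕₚ.≤⇒≤′ t<s) eq) (a-new s)

    -- Distinctness allows at most one empty member; the family is restarted just after it.
    nonEmptyFamily : ∀ {ℓ} {S : Pred Carrier ℓ} → InfinitelyManyDisjointOpensIn X S →
      Σ[ V ∈ (ℕ → Pred Carrier 0ℓ) ]
        (∀ n → NonEmptyOpen X (V n)) × (∀ n → V n ⊆ S) × (∀ m n → m ≢ n → ¬ (V m ≬ V n))
    nonEmptyFamily (V , oV , V⊆S , distinct , disjoint) with em₀ {∃[ n ] ¬ Satisfiable (V n)}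
    ... | no ¬empty = V , (λ n → oV n , stable λ ¬sat → ¬empty (n , ¬sat)) , V⊆S , disjoint
    ... | yes (e , ¬sat) = (λ n → V (shift n)) ,
      (λ n → oV _ , stable λ ¬satₙ → distinct (shift n) e
        (λ eq → ℕₚ.m≢1+n+m e (sym (trans (cong suc (ℕₚ.+-comm n e)) eq)))
        ((λ x∈ → contradiction (_ , x∈) ¬satₙ) , (λ x∈ → contradiction (_ , x∈) ¬sat))) ,
      (λ n → V⊆S _) , λ m n m≢n → disjoint _ _ λ eq → m≢n (ℕₚ.+-cancelˡ-≡ (suc e) m n eq)
      where
      shift : ℕ → ℕ
      shift n = suc e ℕ.+ n

    -- Reduction of Π⁰₃ sets to monitorability

    module Hardness (B : ℕ → Pred Carrier 0ℓ) (oB : ∀ n → IsOpen (B n))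
      (base : ∀ V → IsOpen V → ∀ x → x ∈ V → ∃[ n ] (x ∈ B n × B n ⊆ V))
      (V : ℕ → Pred Carrier 0ℓ)
      (neoV : ∀ n → NonEmptyOpen X (V n)) (V⊆∁H : ∀ n → V n ⊆ ∁ (H X))
      (disjoint : ∀ m n → m ≢ n → ¬ (V m ≬ V n)) where

      -- The place for the points of row `k` in `V n`. The last clause ensures that every non-empty
      -- open part of `V n` contains all points of some row.
      Cell : ℕ → ℕ → Set₁
      Cell n k = Σ[ W ∈ Pred Carrier 0ℓ ] NonEmptyOpen X W × W ⊆ V n ×
        (Satisfiable (B k) → B k ⊆ V n → W ⊆ B k)

      cell : ∀ n k → Cell n k
      cell n k with em₀ {Satisfiable (B k) × B k ⊆ V n}
      ... | yes (sat , Bk⊆V) = B k , (oB k , sat) , Bk⊆V , λ _ _ → id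
      -- By default the whole of `V n`, so that every index triple receives a point.
      ... | no ¬ok = V n , neoV n , id , λ sat Bk⊆V → contradiction (sat , λ {x} → Bk⊆V {x}) ¬ok

      cellAt : ∀ t → Cell (proj₁ (untriple t)) (proj₁ (proj₂ (untriple t)))
      cellAt t = cell _ _

      chosen : Σ[ a ∈ (ℕ → Carrier) ] (∀ t → a t ∈ proj₁ (cellAt t)) ×
                 (∀ t → Thin (a t)) × (∀ s t → a s ≈ a t → s ≡ t)
      chosen = thinPoints (λ t → proj₁ (cellAt t)) (λ t → proj₁ (proj₂ (cellAt t)))
        (λ t x∈ → V⊆∁H _ (proj₁ (proj₂ (proj₂ (cellAt t))) x∈))

      point : ℕ → ℕ → ℕ → Carrier
      point n k j = proj₁ chosen (triple n k j)

      point∈cell : ∀ n k j → point n k j ∈ proj₁ (cell n k)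
      point∈cell n k j = subst (λ (n , k , _) → point′ ∈ proj₁ (cell n k))
        (untriple-triple n k j) (proj₁ (proj₂ chosen) (triple n k j))
        where
        point′ : Carrier
        point′ = point n k j

      point∈V : ∀ n k j → point n k j ∈ V n
      point∈V n k j = proj₁ (proj₂ (proj₂ (cell n k))) (point∈cell n k j)

      point-thin : ∀ n k j → Thin (point n k j)
      point-thin n k j = proj₁ (proj₂ (proj₂ chosen)) (triple n k j)

      point-injective : ∀ n k j n′ k′ j′ → point n k j ≈ point n′ k′ j′ → (n , k , j) ≡ (n′ , k′ , j′)
      point-injective n k j n′ k′ j′ eq = trans (sym (untriple-triple n k j))
        (trans (cong untriple (proj₂ (proj₂ (proj₂ chosen)) (triple n k j) (triple n′ k′ j′) eq))
          (untriple-triple n′ k′ j′))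

      module Reduction (Y : Space) (S : ℕ → Pred ∣ Y ∣ 0ℓ) (sift : ∀ n → ClopenSets.Sifting Y (S n)) where
        open ClopenSets Y
        open OpenSets Y

        E : ℕ → ℕ → ℕ → Pred ∣ Y ∣ 0ℓ
        E n = proj₁ (sift n)

        E-clopen : ∀ n k j → Clopen Y (E n k j)
        E-clopen n = proj₁ (proj₂ (sift n))

        E-unique : ∀ n k i j {y} → y ∈ E n k i → y ∈ E n k j → i ≡ j
        E-unique n = proj₁ (proj₂ (proj₂ (sift n)))

        Hit : Carrier → Pred ∣ Y ∣ 0ℓ
        Hit x y = ∃[ n ] ∃[ k ] ∃[ j ] (x ≈ point n k j × y ∈ E n k j)

        hit⇒E : ∀ n k j {x y} → x ≈ point n k j → y ∈ Hit x → y ∈ E n k j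
        hit⇒E n k j x≈ (n′ , k′ , j′ , x≈′ , y∈E)
          with refl ← point-injective n k j n′ k′ j′ (≈-trans (≈-sym x≈) x≈′) = y∈E

        -- By injectivity `x` is at most one of the chosen points, so `Hit x` is one clopen set of a
        -- sifting or empty. Continuity of `f` in the coordinate `x` follows.
        hit-clopen : ∀ x → Clopen Y (Hit x)
        hit-clopen x with em₀ {∃[ n ] ∃[ k ] ∃[ j ] x ≈ point n k j}
        ... | yes (n , k , j , x≈) = clopen-≐
          ((λ y∈E → n , k , j , x≈ , y∈E) , hit⇒E n k j x≈) (E-clopen n k j)
        ... | no ¬point = clopen-≐ ((λ ()) , λ (n , k , j , x≈ , _) → ¬point (n , k , j , x≈)) clopen-∅

        hit-resp : ∀ {x x′ y y′} → x ≈ x′ → Space._≈_ Y y y′ → y ∈ Hit x → y′ ∈ Hit x′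
        hit-resp x≈x′ y≈y′ (n , k , j , x≈ , y∈E) =
          n , k , j , ≈-trans (≈-sym x≈x′) x≈ , Space.open-resp Y (proj₁ (E-clopen n k j)) y≈y′ y∈E

        hit-⇔ : ∀ {x x′ y y′} → x ≈ x′ → Space._≈_ Y y y′ → y ∈ Hit x ⇔ y′ ∈ Hit x′
        hit-⇔ x≈ y≈ = mk⇔ (hit-resp x≈ y≈) (hit-resp (≈-sym x≈) (Space.≈-sym Y y≈))

        f : Func (Space.setoid Y) (Space.setoid (𝒫 X))
        f = record
          { to = λ y → record
            { to = λ x → does (em₀ {y ∈ Hit x})
            ; cong = λ x≈ → does-⇔ (hit-⇔ x≈ (Space.≈-refl Y)) em₀ em₀
            }
          ; cong = λ y≈ x → does-⇔ (hit-⇔ ≈-refl y≈) em₀ em₀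
          }

        coordinate-open : ∀ x b → Space.IsOpen Y (λ y → (f ⟨$⟩ y) ⟨$⟩ x ≡ b)
        coordinate-open x true = Space.open-≐ Y (dec-true em₀ , true⇒) (proj₁ (hit-clopen x))
        coordinate-open x false = Space.open-≐ Y (dec-false em₀ , false⇒) (proj₂ (hit-clopen x))

        cylinder-open : ∀ c → Space.IsOpen Y (λ y → Cylinder X c (f ⟨$⟩ y))
        cylinder-open [] = Space.open-≐ Y ((λ _ ()) , _) (Space.open-U Y)
        cylinder-open ((x , b) ∷ c) = Space.open-≐ Y
          ((λ { (e , cyl) (here refl) → e ; (e , cyl) (there i) → cyl i }) ,
           λ cyl → cyl (here refl) , λ {_} {_} i → cyl (there i))
          (Space.open-∩ Y (coordinate-open x b) (cylinder-open c))

        f-continuous : Continuous Y (𝒫 X) f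
        f-continuous O oO = Space.open-≐ Y
          ((λ {y} ((z , z∈) , y∈) → proj₂ (proj₂ (oO (f ⟨$⟩ z) z∈)) {f ⟨$⟩ y} λ {_} {_} i → y∈ i) ,
           (λ {y} y∈ → (y , y∈) , λ {_} {_} i → proj₁ (proj₂ (oO (f ⟨$⟩ y) y∈)) i))
          (Space.open-⋃ Y (∃[ y ] (f ⟨$⟩ y) ∈ O) _ λ (y , y∈) → cylinder-open (proj₁ (oO (f ⟨$⟩ y) y∈)))

        Row : ∣ Y ∣ → ℕ → ℕ → Pred Carrier 0ℓ
        Row y n k x = ∃[ j ] (x ≈ point n k j × y ∈ E n k j)

        -- Since `y` lies in at most one set of each row, the row contributes at most one point up
        -- to `_≈_`, and that point is thin.
        row-nowhereDense : ∀ y n k → NowhereDense (Row y n k)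
        row-nowhereDense y n k with em₀ {∃[ j ] y ∈ E n k j}
        ... | no none = nowhereDense-⊆ (λ (j , _ , y∈E) → none (j , y∈E)) nowhereDense-∅
        ... | yes (j , y∈E) = nowhereDense-⊆
          (λ (i , x≈ , y∈E′) → subst (λ i → _ ≈ point n k i) (E-unique n k i j y∈E′ y∈E) x≈)
          (point-thin n k j)

        rows-nowhereDense : ∀ y n m → NowhereDense (λ x → ∃[ k ] (k < m × x ∈ Row y n k))
        rows-nowhereDense y n zero = nowhereDense-⊆ (λ ()) nowhereDense-∅
        rows-nowhereDense y n (suc m) = nowhereDense-⊆
          (λ (k , k<1+m , x∈) → [ (λ k<m → inj₁ (k , k<m , x∈)) ,
             (λ k≡m → inj₂ (subst (λ k → _ ∈ Row y n k) k≡m x∈)) ]′ (ℕₚ.m<1+n⇒m<n∨m≡n k<1+m))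
          (nowhereDense-∪ (rows-nowhereDense y n m) (row-nowhereDense y n m))

        -- Points with another first index lie outside `V n` by disjointness, and the sifting of
        -- `S n` bounds the rows that `y` hits.
        hit∩V⊆rows : ∀ {y n} → y ∉ S n →
          ∃[ m ] (λ x → x ∈ V n × y ∈ Hit x) ⊆ (λ x → ∃[ k ] (k < m × x ∈ Row y n k))
        hit∩V⊆rows {y} {n} y∉S =
          let m , stop = proj₂ (proj₂ (proj₂ (proj₂ (sift n)))) y∉S
          in m , λ { {x} (x∈V , n′ , k , j , x≈ , y∈E) → sameRegion m stop x∈V n′ k j x≈ y∈E (n ℕₚ.≟ n′) }
          where
          sameRegion : ∀ m → (∀ k j → m ≤ k → y ∉ E n k j) → ∀ {x} → x ∈ V n →
            ∀ n′ k j → x ≈ point n′ k j → y ∈ E n′ k j → Dec (n ≡ n′) →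
            ∃[ k ] (k < m × x ∈ Row y n k)
          sameRegion m stop _ _ k j x≈ y∈E (yes refl) =
            k , ℕₚ.≰⇒> (λ m≤k → stop k j m≤k y∈E) , j , x≈ , y∈E
          sameRegion m _ x∈V n′ k j x≈ _ (no n≢n′) = ⊥-elim (disjoint n n′ n≢n′
            (_ , x∈V , open-resp (proj₁ (neoV n′)) (≈-sym x≈) (point∈V n′ k j)))

        -- If `W` meets some `V n`, finitely many nowhere dense rows are avoided inside `V n ∩ W`;
        -- if it meets none, it contains no chosen point. Either way `f ⟨$⟩ y` is false on an open
        -- part of `W`.
        f-monitorable : ∀ {y} → (∀ n → y ∉ S n) → (f ⟨$⟩ y) ∈ Monitorable X
        f-monitorable {y} y∉S = proj₂ monitorable≐ {f ⟨$⟩ y} part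
          where
          part : (f ⟨$⟩ y) ∈ MonitorableIn U
          part W neo@(oW , _) _ with em₀ {∃[ n ] V n ≬ W}
          ... | yes (n , x , x∈V , x∈W) =
            let m , hit⊆ = hit∩V⊆rows (y∉S n)
                O , neoO , O⊆VW , O⊆∁ = rows-nowhereDense y n m (V n ∩ W) (neo-∩ (proj₁ (neoV n)) oW x∈V x∈W)
            in O , neoO , proj₂ ∘ O⊆VW , constant-from {O} (f ⟨$⟩ y) false λ z∈O →
                 dec-false em₀ λ hit → O⊆∁ z∈O (hit⊆ (proj₁ (O⊆VW z∈O) , hit))
          ... | no V≬̸W = W , neo , id , constant-from {W} (f ⟨$⟩ y) false λ z∈W →
            dec-false em₀ λ (n , k , j , z≈ , _) → V≬̸W (n , _ ,
              open-resp (proj₁ (neoV n)) (≈-sym z≈) (point∈V n k j) , z∈W)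

        -- A constant part `W` of `V n` contains a whole row of points. One of them, with index `j`,
        -- is hit; constancy would make its neighbour `suc j` hit as well, against uniqueness within
        -- the row.
        f-¬monitorable : ∀ {y n} → y ∈ S n → (f ⟨$⟩ y) ∉ Monitorable X
        f-¬monitorable {y} {n} y∈S mon =
          let W , (oW , w , w∈W) , W⊆V , const = proj₁ monitorable≐ {f ⟨$⟩ y} mon (V n) (neoV n) _
              k , w∈Bk , Bk⊆W = base W oW w w∈W
              j , y∈E = proj₁ (proj₂ (proj₂ (proj₂ (sift n)))) y∈S k
              inW = λ i → Bk⊆W (proj₂ (proj₂ (proj₂ (cell n k))) (w , w∈Bk) (W⊆V ∘ Bk⊆W) (point∈cell n k i))
              hit = true⇒ (trans (const (inW (suc j)) (inW j)) (dec-true em₀ (n , k , j , ≈-refl , y∈E)))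
          in ℕₚ.1+n≢n (E-unique n k (suc j) j (hit⇒E n k (suc j) ≈-refl hit) y∈E)

      hard : Hard (𝚷⁰ 3) (𝒫 X) (Monitorable X)
      hard Y polish zd C (complement S (union _ G G∈Π (S⊆ , ⊆S)) (C⊆ , ⊆C)) =
        f , f-continuous ,
        (λ y∈C → f-monitorable λ n y∈G → C⊆ y∈C (⊆S (n , y∈G))) ,
        (λ mon → ⊆C λ y∈S → let n , y∈G = S⊆ y∈S in f-¬monitorable y∈G mon)
        where
        G-sifting : ∀ n → ClopenSets.Sifting Y (G n)
        G-sifting n = let β , β<3 , Gn∈Π = G∈Π n in ClopenSets.Π⁰⇒sifting Y polish zd β<3 Gn∈Π

        open Reduction Y G G-sifting

mainTheorem6 : ExcludedMiddle (lsuc 0ℓ) →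
    (X : Space) → CountablyInfinite X → SecondCountable X →
    (InfinitelyManyDisjointOpensIn X (∁ (H X)) ⇔ InfinitelyManyDisjointOpensIn X (L X)) ×
    (InfinitelyManyDisjointOpensIn X (∁ (H X)) → CompleteFor (𝚷⁰ 3) (𝒫 X) (Monitorable X)) ×
    (¬ InfinitelyManyDisjointOpensIn X (∁ (H X)) → InClass (𝚺⁰ 2) (𝒫 X) (Monitorable X))
mainTheorem6 em X _ (B , oB , base) =
  -- Each `V n` is itself the open set witnessing that its points are interior.
  mk⇔ (λ (V , oV , V⊆∁H , rest) → V , oV , (λ n {x} x∈V → V n , oV n , (λ {z} → V⊆∁H n {z}) , x∈V) , rest)
      (λ (V , oV , V⊆L , rest) → V , oV , (λ n x∈V → let _ , _ , W⊆∁H , x∈W = V⊆L n x∈V in W⊆∁H x∈W) , rest) ,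
  (λ inf → let V , neoV , V⊆∁H , disjoint = nonEmptyFamily inf in
    monitorable-Π⁰₃ B oB base , Hardness.hard B oB base V neoV V⊆∁H disjoint) ,
  monitorable-Σ⁰₂ B oB base
  where
  open Classical em
  open Powerset X
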